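{- Let $v \ge 147$ be an integer. Then $\beta(3,v,4) \le v-2$, and \[ \beta(3,v,4) \ge \begin{cases} v-3 & \text{if } v \equiv 0 \text{ or } 1 \pmod 3,\\ v-5 & \text{if } v \equiv 2 \pmod 3. \end{cases} \]
   Context: For integers $v \ge k \ge 2$, a $(v,k)$-packing is a pair $(X,\mathcal{B})$ where $X$ is a set of $v$ points and $\mathcal{B}$ is a set of $k$-subsets of $X$ (blocks) such that every pair of distinct points lies in at most one block. A partial parallel class (PPC) is a set of pairwise disjoint blocks; its size is the number of blocks. A PPC of size $\rho$ is maximum if the packing has no PPC of size $\rho+1$. $\beta(\rho,v,k)$ denotes the maximum number of blocks in a $(v,k)$-packing in which the maximum PPC has size $\rho$. -}

module Defs where

open import Data.Fin using (Fin)
open import Data.Fin.Subset using (Subset; _∈_; _∩_; ∣_∣; Empty)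
open import Data.List using (List; length)
open import Data.List.Membership.Propositional using () renaming (_∈_ to _∈ₗ_)
open import Data.List.Relation.Binary.Subset.Propositional using (_⊆_)
open import Data.List.Relation.Unary.All using (All)
open import Data.List.Relation.Unary.AllPairs using (AllPairs)
open import Data.List.Relation.Unary.Unique.Propositional using (Unique)
open import Data.Nat using (ℕ; suc; _≤_)
open import Data.Product using (∃; _×_)
open import Relation.Binary.PropositionalEquality using (_≡_; _≢_)
open import Relation.Nullary using (¬_)

-- The point set is Fin v.  A set of blocks is a duplicate-free list, so
-- that its cardinality is the length of the list.

record Packing (v k : ℕ) : Set where
  field
    blocks     : List (Subset v)
    distinct   : Unique blocks
    block-size : All (λ B → ∣ B ∣ ≡ k) blocks
    pair-once  : ∀ {x y : Fin v} {B C} → x ≢ y → B ∈ₗ blocks → C ∈ₗ blocks →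
                 x ∈ B → y ∈ B → x ∈ C → y ∈ C → B ≡ C

open Packing public

numBlocks : ∀ {v k} → Packing v k → ℕ
numBlocks P = length (blocks P)

Disjoint : ∀ {v} → Subset v → Subset v → Set
Disjoint B C = Empty (B ∩ C)

record PPC {v k : ℕ} (P : Packing v k) (ρ : ℕ) : Set where
  field
    members  : List (Subset v)
    distinct : Unique members
    ⊆-blocks : members ⊆ blocks P
    disjoint : AllPairs Disjoint members
    size     : length members ≡ ρ

MaxPPCSize : ∀ {v k} → Packing v k → ℕ → Set
MaxPPCSize P ρ = PPC P ρ × ¬ PPC P (suc ρ)

-- "β(ρ,v,k) is defined and equals b".  The maximum is a relation rather
-- than a function because it need not exist for every ρ, v and k.
record β[_,_,_]≡_ (ρ v k b : ℕ) : Set where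
  field
    attained : ∃ λ (P : Packing v k) → MaxPPCSize P ρ × numBlocks P ≡ b
    maximal  : ∀ (P : Packing v k) → MaxPPCSize P ρ → numBlocks P ≤ b

{-# OPTIONS --safe #-}
module Submission where

-- Upper bound.  Call a point high if it lies on more than 12 blocks.  A family
-- M of disjoint blocks and a set H of high points off M with |M| + |H| ≤ 4
-- extend to a PPC of size |M| + |H|, so |M| + |H| ≤ 3 when H consists of all
-- high points and M is a maximal disjoint family among the blocks missing H.
-- Every block meets H or M; points of M have degree at most 12, and points of H
-- have degree at most (v - 1) / 3.  If |H| ≤ 2 this gives at most v - 2 blocks
-- once v ≥ 147; if |H| = 3 all blocks meet H, and two high points cannot both
-- use up all their possible neighbours without sharing a block.
--
-- Lower bound.  Join three points at infinity to three mutually orthogonal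
-- parallel classes of triples on three columns of n points, (a , a + i , a + 2i)
-- mod n for i = 0, 1, 2; if v ≡ 1 (mod 3), the points at infinity and the one
-- leftover point form a further block.
--
-- The exact maximum exists because attainability of a given number of blocks
-- is decidable by finite search.

open import Defs
open import Data.Bool.Properties as Bool using ()
open import Data.Empty using (⊥)
open import Data.Fin using (Fin; zero; suc; toℕ; inject≤)
import Data.Fin.Properties as Fin
open import Data.Fin.Subset using (Subset; inside; outside; _∈_; _∉_; _∩_; _∪_; _─_; _-_; ∁; ⁅_⁆; ⋃; ∣_∣; Nonempty)
open import Data.Fin.Subset.Properties
open import Data.List using (List; []; _∷_; _++_; length; map; filter; take; allFin; tabulate)
open import Data.List.Membership.DecPropositional using () renaming (_∈?_ to member?)
open import Data.List.Membership.Propositional using (find; lose) renaming (_∈_ to _∈ₗ_; _∉_ to _∉ₗ_)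
open import Data.List.Membership.Propositional.Properties
  using (∈-filter⁺; ∈-filter⁻; ∈-allFin; ∈-map⁺; ∈-map⁻; ∈-tabulate⁺; ∈-tabulate⁻)
open import Data.List.Properties using (length-map; length-take; length-tabulate; map-++; filter-accept)
open import Data.List.Relation.Unary.All using (All; []; _∷_; all?)
import Data.List.Relation.Unary.All as All
import Data.List.Relation.Unary.All.Properties as All
open import Data.List.Relation.Unary.AllPairs using (AllPairs; []; _∷_; allPairs?)
import Data.List.Relation.Unary.AllPairs as AllPairs
import Data.List.Relation.Unary.AllPairs.Properties as AllPairs
open import Data.List.Relation.Unary.Any using (Any; here; there; any?)
import Data.List.Relation.Unary.Any as Any
import Data.List.Relation.Unary.Any.Properties as Any
open import Data.List.Relation.Unary.Unique.Propositional using (Unique)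
import Data.List.Relation.Unary.Unique.Propositional.Properties as Unique
open import Data.Nat hiding (∣_-_∣)
open import Data.Nat.DivMod
open import Data.Nat.ListAction using (sum)
open import Data.Nat.ListAction.Properties using (sum-++)
open import Data.Nat.Properties
open import Data.Nat.Solver using (module +-*-Solver)
open import Data.Product using (∃; _×_; _,_; proj₁; proj₂)
open import Data.Sum using (_⊎_; inj₁; inj₂)
open import Data.Sum.Function.Propositional using (_⊎-↔_)
open import Data.Unit using (⊤; tt)
open import Data.Vec using ([]; _∷_; here; there)
import Data.Vec.Properties as Vec
open import Function using (_∘_; case_of_; _↔_; Inverse)
open import Function.Construct.Composition using (_↔-∘_)
open import Function.Construct.Identity using (↔-id)
open import Relation.Binary using (DecidableEquality)
open import Relation.Binary.PropositionalEquality
open import Relation.Nullary using (¬_; Dec; yes; no; ¬?; contradiction)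
open import Relation.Nullary.Decidable using (map′; toWitness; _×-dec_; _→-dec_)
open import Relation.Unary using (Decidable)

-- Lists, sums and finite subsets

allPairs-map-with : ∀ {A : Set} {Q : A → Set} {R T : A → A → Set} →
  (∀ {x y} → Q x → Q y → R x y → T x y) →
  ∀ {xs} → All Q xs → AllPairs R xs → AllPairs T xs
allPairs-map-with f [] [] = []
allPairs-map-with f (qx ∷ qs) (rx ∷ rs) =
  All.zipWith (λ (qy , rxy) → f qx qy rxy) (qs , rx) ∷ allPairs-map-with f qs rs

length-filter-complement : ∀ {A : Set} {Q : A → Set} (Q? : Decidable Q) xs →
  length xs ≡ length (filter Q? xs) + length (filter (¬? ∘ Q?) xs)
length-filter-complement Q? [] = refl
length-filter-complement Q? (x ∷ xs) with Q? x
... | yes _ = cong suc (length-filter-complement Q? xs)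
... | no _ = trans (cong suc (length-filter-complement Q? xs)) (sym (+-suc _ _))

length-filter-∷ : ∀ {A : Set} {Q : A → Set} (Q? : Decidable Q) x xs →
  length (filter Q? xs) ≤ length (filter Q? (x ∷ xs))
length-filter-∷ Q? x xs with Q? x
... | yes _ = n≤1+n _
... | no _ = ≤-refl

sum-map-mono-≤ : ∀ {A : Set} {f g : A → ℕ} → (∀ x → f x ≤ g x) →
  ∀ xs → sum (map f xs) ≤ sum (map g xs)
sum-map-mono-≤ f≤g [] = z≤n
sum-map-mono-≤ f≤g (x ∷ xs) = +-mono-≤ (f≤g x) (sum-map-mono-≤ f≤g xs)

sum-map-mono-< : ∀ {A : Set} {f g : A → ℕ} → (∀ x → f x ≤ g x) →
  ∀ {xs} → Any (λ x → f x < g x) xs → sum (map f xs) < sum (map g xs)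
sum-map-mono-< f≤g {x ∷ xs} (here f<g) = +-mono-<-≤ f<g (sum-map-mono-≤ f≤g xs)
sum-map-mono-< f≤g {x ∷ xs} (there p) = +-mono-≤-< (f≤g x) (sum-map-mono-< f≤g p)

sum-map-≤ : ∀ {A : Set} {f : A → ℕ} {d xs} → All (λ x → f x ≤ d) xs →
  sum (map f xs) ≤ length xs * d
sum-map-≤ [] = z≤n
sum-map-≤ (p ∷ ps) = +-mono-≤ p (sum-map-≤ ps)

∣p∩q∣+∣q─p∣≡∣q∣ : ∀ {v} (p q : Subset v) → ∣ p ∩ q ∣ + ∣ q ─ p ∣ ≡ ∣ q ∣
∣p∩q∣+∣q─p∣≡∣q∣ [] [] = refl
∣p∩q∣+∣q─p∣≡∣q∣ (inside ∷ p) (inside ∷ q) = cong suc (∣p∩q∣+∣q─p∣≡∣q∣ p q)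
∣p∩q∣+∣q─p∣≡∣q∣ (outside ∷ p) (inside ∷ q) =
  trans (+-suc _ _) (cong suc (∣p∩q∣+∣q─p∣≡∣q∣ p q))
∣p∩q∣+∣q─p∣≡∣q∣ (inside ∷ p) (outside ∷ q) = ∣p∩q∣+∣q─p∣≡∣q∣ p q
∣p∩q∣+∣q─p∣≡∣q∣ (outside ∷ p) (outside ∷ q) = ∣p∩q∣+∣q─p∣≡∣q∣ p q

∣p∪q∣≤∣p∣+∣q∣ : ∀ {v} (p q : Subset v) → ∣ p ∪ q ∣ ≤ ∣ p ∣ + ∣ q ∣
∣p∪q∣≤∣p∣+∣q∣ [] [] = z≤n
∣p∪q∣≤∣p∣+∣q∣ (inside ∷ p) (inside ∷ q) =
  s≤s (≤-trans (∣p∪q∣≤∣p∣+∣q∣ p q) (+-monoʳ-≤ ∣ p ∣ (n≤1+n _)))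
∣p∪q∣≤∣p∣+∣q∣ (outside ∷ p) (inside ∷ q) =
  ≤-trans (s≤s (∣p∪q∣≤∣p∣+∣q∣ p q)) (≤-reflexive (sym (+-suc _ _)))
∣p∪q∣≤∣p∣+∣q∣ (inside ∷ p) (outside ∷ q) = s≤s (∣p∪q∣≤∣p∣+∣q∣ p q)
∣p∪q∣≤∣p∣+∣q∣ (outside ∷ p) (outside ∷ q) = ∣p∪q∣≤∣p∣+∣q∣ p q

-- The point `x` and `p ∩ q` cover `p`. Applied to a block and the complement of one of its points,
-- this yields three further points.
∣p∩q∣≥ : ∀ {v n} (p q : Subset v) x → ∣ p ∣ ≡ suc n → (∀ {y} → y ∈ p → y ≢ x → y ∈ q) → n ≤ ∣ p ∩ q ∣
∣p∩q∣≥ {n = n} p q x p≡ p-x⊆q = s≤s⁻¹ (begin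
  suc n                   ≡⟨ p≡ ⟨
  ∣ p ∣                   ≤⟨ p⊆q⇒∣p∣≤∣q∣ split ⟩
  ∣ ⁅ x ⁆ ∪ p ∩ q ∣       ≤⟨ ∣p∪q∣≤∣p∣+∣q∣ ⁅ x ⁆ (p ∩ q) ⟩
  ∣ ⁅ x ⁆ ∣ + ∣ p ∩ q ∣   ≡⟨ cong (_+ ∣ p ∩ q ∣) (∣⁅x⁆∣≡1 x) ⟩
  suc ∣ p ∩ q ∣           ∎)
  where
  open ≤-Reasoning
  split : ∀ {y} → y ∈ p → y ∈ ⁅ x ⁆ ∪ p ∩ q
  split {y} y∈p with y Fin.≟ x
  ... | yes refl = x∈p∪q⁺ (inj₁ (x∈⁅x⁆ x))
  ... | no y≢x = x∈p∪q⁺ (inj₂ (x∈p∩q⁺ (y∈p , p-x⊆q y∈p y≢x)))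

nonempty⇒∣p∣>0 : ∀ {v} {p : Subset v} → Nonempty p → 1 ≤ ∣ p ∣
nonempty⇒∣p∣>0 (x , x∈p) = ≤-<-trans z≤n (x∈p⇒∣p-x∣<∣p∣ x∈p)

∣p∣>0⇒nonempty : ∀ {v n} (p : Subset v) → ∣ p ∣ ≡ suc n → Nonempty p
∣p∣>0⇒nonempty {v} p eq with nonempty? p
... | yes ne = ne
... | no e = contradiction (trans (sym (∣⊥∣≡0 v)) (trans (cong ∣_∣ (sym (Empty-unique e))) eq)) λ ()

∈⋃⁺ : ∀ {v} {x : Fin v} {B L} → B ∈ₗ L → x ∈ B → x ∈ ⋃ L
∈⋃⁺ (here refl) x∈B = x∈p∪q⁺ (inj₁ x∈B)
∈⋃⁺ (there B∈L) x∈B = x∈p∪q⁺ (inj₂ (∈⋃⁺ B∈L x∈B))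

∈⋃⁻ : ∀ {v} {x : Fin v} L → x ∈ ⋃ L → Any (x ∈_) L
∈⋃⁻ [] x∈ = contradiction x∈ ∉⊥
∈⋃⁻ (B ∷ L) x∈ with x∈p∪q⁻ B (⋃ L) x∈
... | inj₁ x∈B = here x∈B
... | inj₂ x∈L = there (∈⋃⁻ L x∈L)

∣⋃∣≤ : ∀ {v k} {L : List (Subset v)} → All (λ B → ∣ B ∣ ≤ k) L → ∣ ⋃ L ∣ ≤ length L * k
∣⋃∣≤ {v} [] = ≤-reflexive (∣⊥∣≡0 v)
∣⋃∣≤ {L = B ∷ L} (p ∷ ps) = ≤-trans (∣p∪q∣≤∣p∣+∣q∣ B (⋃ L)) (+-mono-≤ p (∣⋃∣≤ ps))

fromList : ∀ {v} → List (Fin v) → Subset v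
fromList xs = ⋃ (map ⁅_⁆ xs)

∈-fromList⁺ : ∀ {v} {x : Fin v} {xs} → x ∈ₗ xs → x ∈ fromList xs
∈-fromList⁺ {x = x} x∈xs = ∈⋃⁺ (∈-map⁺ ⁅_⁆ x∈xs) (x∈⁅x⁆ x)

∈-fromList⁻ : ∀ {v} {x : Fin v} xs → x ∈ fromList xs → x ∈ₗ xs
∈-fromList⁻ xs x∈ = Any.map (x∈⁅y⁆⇒x≡y _) (Any.map⁻ (∈⋃⁻ (map ⁅_⁆ xs) x∈))

∣fromList∣≤length : ∀ {v} (xs : List (Fin v)) → ∣ fromList xs ∣ ≤ length xs
∣fromList∣≤length xs = begin
  ∣ fromList xs ∣          ≤⟨ ∣⋃∣≤ (All.map⁺ (All.universal (λ x → ≤-reflexive (∣⁅x⁆∣≡1 x)) xs)) ⟩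
  length (map ⁅_⁆ xs) * 1  ≡⟨ *-identityʳ _ ⟩
  length (map ⁅_⁆ xs)      ≡⟨ length-map ⁅_⁆ xs ⟩
  length xs                ∎
  where open ≤-Reasoning

elements : ∀ {v} → Subset v → List (Fin v)
elements [] = []
elements (inside ∷ p) = zero ∷ map suc (elements p)
elements (outside ∷ p) = map suc (elements p)

∈-elements : ∀ {v} {x : Fin v} {p} → x ∈ p → x ∈ₗ elements p
∈-elements here = here refl
∈-elements {p = inside ∷ p} (there x∈p) = there (∈-map⁺ suc (∈-elements x∈p))
∈-elements {p = outside ∷ p} (there x∈p) = ∈-map⁺ suc (∈-elements x∈p)

elements-all : ∀ {v} {Q : Fin v → Set} {p} → (∀ {x} → x ∈ p → Q x) → All Q (elements p)
elements-all {p = []} f = []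
elements-all {p = inside ∷ p} f = f here ∷ All.map⁺ (elements-all (f ∘ there))
elements-all {p = outside ∷ p} f = All.map⁺ (elements-all (f ∘ there))

length-elements : ∀ {v} (p : Subset v) → length (elements p) ≡ ∣ p ∣
length-elements [] = refl
length-elements (inside ∷ p) = cong suc (trans (length-map suc (elements p)) (length-elements p))
length-elements (outside ∷ p) = trans (length-map suc (elements p)) (length-elements p)

∈⇒length>0 : ∀ {A : Set} {x : A} {xs} → x ∈ₗ xs → 1 ≤ length xs
∈⇒length>0 {xs = _ ∷ _} _ = s≤s z≤n

-- The upper bound

-- Disjointness is taken relative to `U` because blocks through a common point are disjoint only
-- away from it.
DisjointIn : ∀ {v} → Subset v → Subset v → Subset v → Set
DisjointIn U B C = ∀ y → y ∈ B → y ∈ C → y ∉ U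

-- Remove the points of `B` from `U`: the later sets share none of them inside `U`, so each keeps
-- its `k` points in what remains.
disjointIn-count : ∀ {v} k (U : Subset v) {L} → AllPairs (DisjointIn U) L →
  All (λ B → k ≤ ∣ B ∩ U ∣) L → length L * k ≤ ∣ U ∣
disjointIn-count k U [] [] = z≤n
disjointIn-count k U {B ∷ L} (dB ∷ dL) (kB ∷ kL) = begin
  k + length L * k        ≤⟨ +-mono-≤ kB (disjointIn-count k (U ─ B)
                               (AllPairs.map (λ d y y∈C y∈D → d y y∈C y∈D ∘ p─q⊆p U B) dL)
                               (All.zipWith (λ (d , kC) → ≤-trans kC (p⊆q⇒∣p∣≤∣q∣ (shrink d))) (dB , kL))) ⟩
  ∣ B ∩ U ∣ + ∣ U ─ B ∣   ≡⟨ ∣p∩q∣+∣q─p∣≡∣q∣ B U ⟩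
  ∣ U ∣                   ∎
  where
  open ≤-Reasoning
  shrink : ∀ {C} → DisjointIn U B C → ∀ {y} → y ∈ C ∩ U → y ∈ C ∩ (U ─ B)
  shrink {C} d y∈ with y∈C , y∈U ← x∈p∩q⁻ C U y∈ =
    x∈p∩q⁺ (y∈C , x∈p∧x∉q⇒x∈p─q y∈U (λ y∈B → d _ y∈B y∈C y∈U))

through : ∀ {v} → Fin v → List (Subset v) → List (Subset v)
through x = filter (x ∈?_)

degree : ∀ {v k} → Packing v k → Fin v → ℕ
degree P x = length (through x (blocks P))

-- Distinct blocks of a packing through x are disjoint away from x.
star-count : ∀ {v k} (P : Packing v k) j {x U S} → Unique S → (∀ {B} → B ∈ₗ S → B ∈ₗ blocks P) →
  All (x ∈_) S → x ∉ U → All (λ B → j ≤ ∣ B ∩ U ∣) S → length S * j ≤ ∣ U ∣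
star-count P j {x} {U} S! S⊆P x∈S x∉U = disjointIn-count j U
  (allPairs-map-with disj (All.zip (All.tabulate S⊆P , x∈S)) S!)
  where
  disj : ∀ {B C} → B ∈ₗ blocks P × x ∈ B → C ∈ₗ blocks P × x ∈ C → B ≢ C → DisjointIn U B C
  disj (B∈P , x∈B) (C∈P , x∈C) B≢C y y∈B y∈C y∈U =
    B≢C (pair-once P (λ { refl → x∉U y∈U }) B∈P C∈P x∈B y∈B x∈C y∈C)

-- Each further block raises some summand by one, at a point of `Q` on it, and lowers none.
cover-count : ∀ {v} (Q : List (Fin v)) {L} → All (λ B → Any (_∈ B) Q) L →
  length L ≤ sum (map (λ x → length (through x L)) Q)
cover-count Q [] = z≤n
cover-count Q {B ∷ L} (hit ∷ hits) = ≤-<-trans (cover-count Q hits)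
  (sum-map-mono-< (λ x → length-filter-∷ (x ∈?_) B L)
    (Any.map (λ {x} x∈B → ≤-reflexive (sym (cong length (filter-accept (x ∈?_) x∈B)))) hit))

-- If all blocks through `x` met `U`, they would use different points of `U`, being disjoint away
-- from `x`, and the degree could not exceed the size of `U`.
block-avoiding : ∀ {v k} (P : Packing v k) {x U} → x ∉ U → ∣ U ∣ < degree P x →
  ∃ λ B → B ∈ₗ blocks P × x ∈ B × (∀ {y} → y ∈ B → y ∉ U)
block-avoiding P {x} {U} x∉U U<deg with all? (λ B → nonempty? (B ∩ U)) (through x (blocks P))
... | no ¬all with B , B∈ , e ← find (All.¬All⇒Any¬ (λ B → nonempty? (B ∩ U)) _ ¬all)
  with B∈P , x∈B ← ∈-filter⁻ (x ∈?_) B∈ =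
  B , B∈P , x∈B , λ y∈B y∈U → e (_ , x∈p∩q⁺ (y∈B , y∈U))
... | yes all = contradiction
  (subst (_≤ ∣ U ∣) (*-identityʳ _)
    (star-count P 1 (Unique.filter⁺ (x ∈?_) (Packing.distinct P)) (λ B∈ → proj₁ (∈-filter⁻ (x ∈?_) B∈))
      (All.all-filter (x ∈?_) (blocks P)) x∉U (All.map nonempty⇒∣p∣>0 all)))
  (<⇒≱ U<deg)

-- A longer disjoint family would contain one of size exactly `suc ρ`. Blocks are nonempty, so
-- disjointness already makes the members distinct.
¬ppc⇒length≤ : ∀ {v k ρ} (P : Packing v (suc k)) → ¬ PPC P (suc ρ) → ∀ {M} →
  (∀ {B} → B ∈ₗ M → B ∈ₗ blocks P) → AllPairs Disjoint M → length M ≤ ρ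
¬ppc⇒length≤ {ρ = ρ} P ¬ppc {M} M⊆P disj = ≮⇒≥ λ ρ<M → ¬ppc record
  { members  = take (suc ρ) M
  ; distinct = AllPairs.take⁺ (suc ρ) (allPairs-map-with separate (All.tabulate M⊆P) disj)
  ; ⊆-blocks = All.lookup (All.take⁺ (suc ρ) (All.tabulate M⊆P))
  ; disjoint = AllPairs.take⁺ (suc ρ) disj
  ; size     = trans (length-take (suc ρ) M) (m≤n⇒m⊓n≡m ρ<M)
  }
  where
  separate : ∀ {B C} → B ∈ₗ blocks P → C ∈ₗ blocks P → Disjoint B C → B ≢ C
  separate {B} B∈P _ B#C refl with x , x∈B ← ∣p∣>0⇒nonempty B (All.lookup (block-size P) B∈P) =
    B#C (x , x∈p∩q⁺ (x∈B , x∈B))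

-- Greedy choice: a set joins only if it misses the union so far. Maximality is stated as meeting
-- that union, which for a chosen set rests on its being nonempty.
maximal-disjoint : ∀ {v} (L : List (Subset v)) → All Nonempty L →
  ∃ λ M → (∀ {B} → B ∈ₗ M → B ∈ₗ L) × AllPairs Disjoint M × All (λ B → Nonempty (B ∩ ⋃ M)) L
maximal-disjoint [] [] = [] , (λ ()) , [] , []
maximal-disjoint (B ∷ L) ((x , x∈B) ∷ ne) with maximal-disjoint L ne
... | M , M⊆L , disj , meets with nonempty? (B ∩ ⋃ M)
...   | yes p = M , there ∘ M⊆L , disj , p ∷ meets
...   | no ¬p = B ∷ M , (λ { (here refl) → here refl ; (there C∈M) → there (M⊆L C∈M) }) ,
  All.tabulate (λ {C} C∈M (y , y∈) → let y∈B , y∈C = x∈p∩q⁻ B C y∈ in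
    ¬p (y , x∈p∩q⁺ (y∈B , ∈⋃⁺ C∈M y∈C))) ∷ disj ,
  (x , x∈p∩q⁺ (x∈B , x∈p∪q⁺ (inj₁ x∈B))) ∷
  All.map (λ {C} (y , y∈) → let y∈C , y∈M = x∈p∩q⁻ C (⋃ M) y∈ in
    y , x∈p∩q⁺ (y∈C , x∈p∪q⁺ (inj₂ y∈M))) meets

-- Each point of H can in turn be given a block avoiding the blocks chosen so
-- far and the rest of H: together these have at most 12 points.
extend : ∀ {v} (P : Packing v 4) → ¬ PPC P 4 → ∀ M H →
  (∀ {B} → B ∈ₗ M → B ∈ₗ blocks P) → AllPairs Disjoint M →
  Unique H → All (λ x → 12 < degree P x) H → All (_∉ ⋃ M) H →
  length M + length H ≤ 3
extend P ¬ppc M [] M⊆P disj H! high H∉M =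
  subst (_≤ 3) (sym (+-identityʳ _)) (¬ppc⇒length≤ P ¬ppc M⊆P disj)
extend P ¬ppc M (x ∷ H) M⊆P disj (x∉H ∷ H!) (dx ∷ dH) (x∉M ∷ H∉M)
  with block-avoiding P x∉U (≤-<-trans U≤12 dx)
  where
  U = ⋃ M ∪ fromList H
  x∉U : x ∉ U
  x∉U x∈U with x∈p∪q⁻ (⋃ M) (fromList H) x∈U
  ... | inj₁ x∈M = x∉M x∈M
  ... | inj₂ x∈H = All.lookup x∉H (∈-fromList⁻ H x∈H) refl
  -- The lemma for the shorter list `H` already bounds |M| + |H| by 3; a point of `H` is charged 4,
  -- just like a block of `M`, which gives 3 · 4.
  U≤12 : ∣ U ∣ ≤ 12
  U≤12 = begin
    ∣ U ∣                           ≤⟨ ∣p∪q∣≤∣p∣+∣q∣ (⋃ M) (fromList H) ⟩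
    ∣ ⋃ M ∣ + ∣ fromList H ∣        ≤⟨ +-mono-≤ (∣⋃∣≤ (All.tabulate (λ B∈M → ≤-reflexive (All.lookup (block-size P) (M⊆P B∈M)))))
                                                (≤-trans (∣fromList∣≤length H) (m≤m*n _ 4)) ⟩
    length M * 4 + length H * 4     ≡⟨ *-distribʳ-+ 4 (length M) (length H) ⟨
    (length M + length H) * 4       ≤⟨ *-monoˡ-≤ 4 (extend P ¬ppc M H M⊆P disj H! dH H∉M) ⟩
    12                              ∎
    where open ≤-Reasoning
... | B , B∈P , x∈B , avoid = subst (_≤ 3) (sym (+-suc (length M) (length H)))
  (extend P ¬ppc (B ∷ M) H (λ { (here refl) → B∈P ; (there C∈M) → M⊆P C∈M })
    (All.tabulate (λ {C} C∈M (y , y∈) → let y∈B , y∈C = x∈p∩q⁻ B C y∈ in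
      avoid y∈B (x∈p∪q⁺ (inj₁ (∈⋃⁺ C∈M y∈C)))) ∷ disj)
    H! dH
    (All.tabulate λ y∈H y∈BM → case x∈p∪q⁻ B (⋃ M) y∈BM of λ where
      (inj₁ y∈B) → avoid y∈B (x∈p∪q⁺ (inj₂ (∈-fromList⁺ y∈H)))
      (inj₂ y∈M) → All.lookup H∉M y∈H y∈M))

-- The blocks through `x` cut disjoint triples out of the `v ∸ 1` other points.
degree-bound : ∀ {v} (P : Packing v 4) x → degree P x * 3 ≤ v ∸ 1
degree-bound {v} P x = begin
  degree P x * 3   ≤⟨ star-count P 3 {U = ∁ ⁅ x ⁆} (Unique.filter⁺ (x ∈?_) (Packing.distinct P))
                        (λ B∈ → proj₁ (∈-filter⁻ (x ∈?_) B∈))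
                        (All.all-filter (x ∈?_) (blocks P)) (x∈p⇒x∉∁p (x∈⁅x⁆ x))
                        (All.filter⁺ (x ∈?_) (All.map (λ {B} B≡4 → ∣p∩q∣≥ B (∁ ⁅ x ⁆) x B≡4 λ _ y≢x → x∉p⇒x∈∁p (x≢y⇒x∉⁅y⁆ y≢x)) (block-size P))) ⟩
  ∣ ∁ ⁅ x ⁆ ∣      ≡⟨ ∣∁p∣≡n∸∣p∣ ⁅ x ⁆ ⟩
  v ∸ ∣ ⁅ x ⁆ ∣    ≡⟨ cong (v ∸_) (∣⁅x⁆∣≡1 x) ⟩
  v ∸ 1            ∎
  where open ≤-Reasoning

_∉?_ : ∀ {v} (x : Fin v) → Decidable (x ∉_)
x ∉? B = ¬? (x ∈? B)

missing : ∀ {v} → Fin v → List (Subset v) → List (Subset v)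
missing x = filter (x ∉?_)

-- These blocks cut disjoint triples out of the points other than both `x` and `y`.
degree-missing-bound : ∀ {v} (P : Packing v 4) {x y} → x ≢ y →
  length (through y (missing x (blocks P))) * 3 ≤ v ∸ 2
degree-missing-bound {v} P {x} {y} x≢y = begin
  length S * 3     ≤⟨ star-count P 3 {U = U} (Unique.filter⁺ (y ∈?_) (Unique.filter⁺ (x ∉?_) (Packing.distinct P)))
                        (λ B∈ → proj₁ (mem B∈)) (All.all-filter (y ∈?_) (missing x (blocks P)))
                        (x∈p⇒x∉∁p (x∈⁅x⁆ y) ∘ p─q⊆p (∁ ⁅ y ⁆) ⁅ x ⁆)
                        (All.tabulate λ {B} B∈ → ∣p∩q∣≥ B U y (All.lookup (block-size P) (proj₁ (mem B∈)))
                          λ z∈B z≢y → x∈p∧x≢y⇒x∈p-y (x∉p⇒x∈∁p (x≢y⇒x∉⁅y⁆ z≢y)) λ { refl → proj₂ (mem B∈) z∈B }) ⟩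
  ∣ U ∣            ≤⟨ ∣U∣≤v∸2 ⟩
  v ∸ 2            ∎
  where
  open ≤-Reasoning
  U = ∁ ⁅ y ⁆ - x
  S = through y (missing x (blocks P))
  mem : ∀ {B} → B ∈ₗ S → B ∈ₗ blocks P × x ∉ B
  mem B∈ = ∈-filter⁻ (x ∉?_) (proj₁ (∈-filter⁻ (y ∈?_) B∈))
  ∣U∣≤v∸2 : ∣ U ∣ ≤ v ∸ 2
  ∣U∣≤v∸2 = subst (∣ U ∣ ≤_) (trans (cong pred (trans (∣∁p∣≡n∸∣p∣ ⁅ y ⁆) (cong (v ∸_) (∣⁅x⁆∣≡1 y)))) (pred[m∸n]≡m∸[1+n] v 1))
    (<⇒≤pred (x∈p⇒∣p-x∣<∣p∣ (x∉p⇒x∈∁p (x≢y⇒x∉⁅y⁆ x≢y))))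

-- Since 48 ≤ e, trading a block for a high point never lowers the total, so the extreme case is two
-- high points and one block.
few-high-arith : ∀ {w m h e} → 48 ≤ e → suc (2 * e + 48) ≤ w → m + h ≤ 3 → h ≤ 2 →
  h * e + m * 48 < w
few-high-arith {w} {m} {h} {e} 48≤e bound m+h≤3 h≤2 = ≤-trans (s≤s (begin
  h * e + m * 48               ≤⟨ +-monoʳ-≤ (h * e) (*-monoˡ-≤ 48 m≤) ⟩
  h * e + suc (2 ∸ h) * 48     ≡⟨ cong (h * e +_) (+-comm 48 ((2 ∸ h) * 48)) ⟩
  h * e + ((2 ∸ h) * 48 + 48)  ≤⟨ +-monoʳ-≤ (h * e) (+-monoˡ-≤ 48 (*-monoʳ-≤ (2 ∸ h) 48≤e)) ⟩
  h * e + ((2 ∸ h) * e + 48)   ≡⟨ +-assoc (h * e) _ 48 ⟨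
  h * e + (2 ∸ h) * e + 48     ≡⟨ cong (_+ 48) (*-distribʳ-+ e h (2 ∸ h)) ⟨
  (h + (2 ∸ h)) * e + 48       ≡⟨ cong (λ n → n * e + 48) (m+[n∸m]≡n h≤2) ⟩
  2 * e + 48                   ∎)) bound
  where
  open ≤-Reasoning
  m≤ : m ≤ suc (2 ∸ h)
  m≤ = subst (m ≤_) (+-∸-assoc 1 h≤2) (m+n≤o⇒m≤o∸n m m+h≤3)

-- For q = w / 3 at least 49, 2q + 49 ≤ 3q ≤ w; otherwise e = 48 and the left side is 145.
third-arith : ∀ {w} → 146 ≤ w → let e = 48 ⊔ w / 3 in suc (2 * e + 48) ≤ w
third-arith {w} 146≤w with ≤-<-connex (w / 3) 48
... | inj₂ 49≤q = subst (λ e → suc (2 * e + 48) ≤ w) (sym (m≤n⇒m⊔n≡n (≤-trans (n≤1+n 48) 49≤q))) (begin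
  suc (2 * (w / 3) + 48)    ≡⟨ +-suc (2 * (w / 3)) 48 ⟨
  2 * (w / 3) + 49          ≤⟨ +-monoʳ-≤ (2 * (w / 3)) 49≤q ⟩
  2 * (w / 3) + w / 3       ≡⟨ solve 1 (λ q → con 2 :* q :+ q := q :* con 3) refl (w / 3) ⟩
  w / 3 * 3                 ≤⟨ m/n*n≤m w 3 ⟩
  w                         ∎)
  where
  open ≤-Reasoning
  open +-*-Solver
... | inj₁ q≤48 = subst (λ e → suc (2 * e + 48) ≤ w) (sym (m≥n⇒m⊔n≡m q≤48)) (≤-trans (n≤1+n 145) 146≤w)


module UpperBound {v : ℕ} (v≥147 : v ≥ 147) (P : Packing v 4) (¬ppc : ¬ PPC P 4) where

  High : Fin v → Set
  High x = 12 < degree P x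

  high? : Decidable High
  high? x = 12 <? degree P x

  H : List (Fin v)
  H = filter high? (allFin v)

  H! : Unique H
  H! = Unique.filter⁺ high? (Unique.allFin⁺ v)

  meetsH? : Decidable (λ B → Any (_∈ B) H)
  meetsH? B = any? (_∈? B) H

  F : List (Subset v)
  F = filter (¬? ∘ meetsH?) (blocks P)

  F⁻ : ∀ {B} → B ∈ₗ F → B ∈ₗ blocks P × ¬ Any (_∈ B) H
  F⁻ = ∈-filter⁻ (¬? ∘ meetsH?)

  greedy = maximal-disjoint F
    (All.tabulate λ {B} B∈F → ∣p∣>0⇒nonempty B (All.lookup (block-size P) (proj₁ (F⁻ B∈F))))

  M : List (Subset v)
  M = proj₁ greedy

  M⊆F : ∀ {B} → B ∈ₗ M → B ∈ₗ F
  M⊆F = proj₁ (proj₂ greedy)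

  ∈⋃M⇒∉H : ∀ {x} → x ∈ ⋃ M → x ∉ₗ H
  ∈⋃M⇒∉H x∈M x∈H with B , B∈M , x∈B ← find (∈⋃⁻ M x∈M) = proj₂ (F⁻ (M⊆F B∈M)) (lose x∈H x∈B)

  ∣M∣+∣H∣≤3 : length M + length H ≤ 3
  ∣M∣+∣H∣≤3 = extend P ¬ppc M H (λ B∈M → proj₁ (F⁻ (M⊆F B∈M))) (proj₁ (proj₂ (proj₂ greedy))) H!
    (All.all-filter high? (allFin v)) (All.tabulate λ x∈H x∈M → ∈⋃M⇒∉H x∈M x∈H)

  Q : List (Fin v)
  Q = H ++ elements (⋃ M)

  -- A block missing `H` lies in `F`, so the maximality of `M` makes it meet `⋃ M`.
  covered : All (λ B → Any (_∈ B) Q) (blocks P)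
  covered = All.tabulate cov
    where
    cov : ∀ {B} → B ∈ₗ blocks P → Any (_∈ B) Q
    cov {B} B∈P with meetsH? B
    ... | yes p = Any.++⁺ˡ p
    ... | no ¬p with y , y∈ ← All.lookup (proj₂ (proj₂ (proj₂ greedy))) (∈-filter⁺ (¬? ∘ meetsH?) B∈P ¬p)
                with y∈B , y∈M ← x∈p∩q⁻ B (⋃ M) y∈ = Any.++⁺ʳ H (lose (∈-elements y∈M) y∈B)

  -- `H` contains every high point, and the members of `M` miss `H`.
  low : ∀ {x} → x ∈ ⋃ M → degree P x ≤ 12
  low {x} x∈M = ≮⇒≥ λ d → ∈⋃M⇒∉H x∈M (∈-filter⁺ high? (∈-allFin x) d)

  ∣⋃M∣≤ : ∣ ⋃ M ∣ ≤ length M * 4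
  ∣⋃M∣≤ = ∣⋃∣≤ (All.tabulate λ B∈M → ≤-reflexive (All.lookup (block-size P) (proj₁ (F⁻ (M⊆F B∈M)))))

  third : ∀ x → degree P x ≤ (v ∸ 1) / 3
  third x = subst (_≤ (v ∸ 1) / 3) (m*n/n≡m (degree P x) 3) (/-mono-≤ (degree-bound P x) ≤-refl)

  -- A block of M accounts for at most 4 · 12 = 48 blocks, a point of H for at most e.
  few-high : length H ≤ 2 → numBlocks P ≤ v ∸ 2
  few-high h≤2 = subst (numBlocks P ≤_) (pred[m∸n]≡m∸[1+n] v 1) (<⇒≤pred (begin-strict
    numBlocks P                                                ≤⟨ cover-count Q covered ⟩
    sum (map (degree P) Q)                                     ≡⟨ cong sum (map-++ (degree P) H _) ⟩
    sum (map (degree P) H ++ map (degree P) (elements (⋃ M)))  ≡⟨ sum-++ (map (degree P) H) _ ⟩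
    sum (map (degree P) H) + sum (map (degree P) (elements (⋃ M)))
      ≤⟨ +-mono-≤ (sum-map-≤ (All.universal (λ x → ≤-trans (third x) (m≤n⊔m 48 ((v ∸ 1) / 3))) H)) (sum-map-≤ (elements-all low)) ⟩
    length H * e + length (elements (⋃ M)) * 12                ≡⟨ cong (λ n → length H * e + n * 12) (length-elements (⋃ M)) ⟩
    length H * e + ∣ ⋃ M ∣ * 12                                ≤⟨ +-monoʳ-≤ (length H * e) (*-monoˡ-≤ 12 ∣⋃M∣≤) ⟩
    length H * e + length M * 4 * 12                           ≡⟨ cong (length H * e +_) (*-assoc (length M) 4 12) ⟩
    length H * e + length M * 48                               <⟨ few-high-arith (m≤m⊔n 48 ((v ∸ 1) / 3)) (third-arith (∸-monoˡ-≤ 1 v≥147)) ∣M∣+∣H∣≤3 h≤2 ⟩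
    v ∸ 1                                                      ∎))
    where
    open ≤-Reasoning
    -- The maximum with 48 ensures that a high point is never charged less than a block of `M`.
    e = 48 ⊔ (v ∸ 1) / 3

  -- Three high points use up the bound |M| + |H| ≤ 3, so `M` is empty; a block missing `H` would
  -- have to meet the empty union.
  many-high : 3 ≤ length H → All (λ B → Any (_∈ B) H) (blocks P)
  many-high h≥3 = All.tabulate hit
    where
    M-empty : ∀ {B} → B ∉ₗ M
    M-empty B∈M = <⇒≱ (+-mono-≤ (∈⇒length>0 B∈M) h≥3) ∣M∣+∣H∣≤3
    hit : ∀ {B} → B ∈ₗ blocks P → Any (_∈ B) H
    hit {B} B∈P with meetsH? B
    ... | yes p = p
    ... | no ¬p with y , y∈ ← All.lookup (proj₂ (proj₂ (proj₂ greedy))) (∈-filter⁺ (¬? ∘ meetsH?) B∈P ¬p)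
                with _ , C∈M , _ ← find (∈⋃⁻ M (proj₂ (x∈p∩q⁻ B (⋃ M) y∈))) = contradiction C∈M M-empty

-- The hypotheses add up to 3(a + b + c) ≤ 3w + 1, and the excess of 1 is lost on dividing by 3.
three-arith : ∀ {w a b c} → a * 3 ≤ suc w → b * 3 ≤ w → c * 3 ≤ w → a + (b + c) ≤ w
three-arith {w} {a} {b} {c} pa pb pc = s≤s⁻¹ (*-cancelʳ-< 3 (a + (b + c)) (suc w) (begin-strict
  (a + (b + c)) * 3          ≡⟨ solve 3 (λ a b c → (a :+ (b :+ c)) :* con 3 := a :* con 3 :+ (b :* con 3 :+ c :* con 3)) refl a b c ⟩
  a * 3 + (b * 3 + c * 3)    ≤⟨ +-mono-≤ pa (+-mono-≤ pb pc) ⟩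
  suc w + (w + w)            <⟨ ≤-refl ⟩
  suc (suc w + (w + w))      ≤⟨ n≤1+n _ ⟩
  suc (suc (suc w + (w + w))) ≡⟨ solve 1 (λ w → con 3 :+ (w :+ (w :+ w)) := (con 1 :+ w) :* con 3) refl w ⟩
  suc w * 3                  ∎))
  where
  open ≤-Reasoning
  open +-*-Solver

-- Counting the blocks through y or z only among those missing x saves one
-- point in each of their degree bounds, which is what brings v ∸ 1 down to v ∸ 2.
three-points : ∀ {v} → 2 ≤ v → (P : Packing v 4) {x y z : Fin v} → x ≢ y → x ≢ z →
  All (λ B → Any (_∈ B) (x ∷ y ∷ z ∷ [])) (blocks P) → numBlocks P ≤ v ∸ 2
three-points {v} 2≤v P {x} {y} {z} x≢y x≢z hits = begin
  numBlocks P                     ≡⟨ length-filter-complement (x ∈?_) (blocks P) ⟩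
  degree P x + length L           ≤⟨ +-monoʳ-≤ (degree P x) (cover-count (y ∷ z ∷ []) (All.tabulate hitL)) ⟩
  degree P x + (dy + (dz + 0))    ≡⟨ cong (λ n → degree P x + (dy + n)) (+-identityʳ dz) ⟩
  degree P x + (dy + dz)          ≤⟨ three-arith {a = degree P x} {b = dy} {c = dz} (subst (degree P x * 3 ≤_) (+-∸-assoc 1 2≤v) (degree-bound P x)) (degree-missing-bound P x≢y) (degree-missing-bound P x≢z) ⟩
  v ∸ 2                           ∎
  where
  open ≤-Reasoning
  L = missing x (blocks P)
  dy = length (through y L)
  dz = length (through z L)
  hitL : ∀ {B} → B ∈ₗ L → Any (_∈ B) (y ∷ z ∷ [])
  hitL B∈L with ∈-filter⁻ (x ∉?_) B∈L
  ... | B∈P , x∉B with All.lookup hits B∈P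
  ...   | here x∈B = contradiction x∈B x∉B
  ...   | there p = p

numBlocks-≤ : ∀ {v} → v ≥ 147 → (P : Packing v 4) → ¬ PPC P 4 → numBlocks P ≤ v ∸ 2
numBlocks-≤ {v} v≥147 P ¬ppc = by-H H refl
  where
  open UpperBound v≥147 P ¬ppc
  -- The cases are the number of high points; a fourth one would violate |M| + |H| ≤ 3.
  by-H : ∀ hs → hs ≡ H → numBlocks P ≤ v ∸ 2
  by-H [] eq = few-high (subst (λ hs → length hs ≤ 2) eq z≤n)
  by-H (_ ∷ []) eq = few-high (subst (λ hs → length hs ≤ 2) eq (s≤s z≤n))
  by-H (_ ∷ _ ∷ []) eq = few-high (subst (λ hs → length hs ≤ 2) eq (s≤s (s≤s z≤n)))
  by-H (x ∷ y ∷ z ∷ []) eq with subst Unique (sym eq) H!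
  ... | (x≢y ∷ x≢z ∷ []) ∷ _ = three-points (≤-trans (s≤s (s≤s z≤n)) v≥147) P x≢y x≢z
    (subst (λ hs → All (λ B → Any (_∈ B) hs) (blocks P)) (sym eq)
      (many-high (subst (λ hs → 3 ≤ length hs) eq ≤-refl)))
  by-H (_ ∷ _ ∷ _ ∷ _ ∷ _) eq = contradiction (m+n≤o⇒n≤o (length M) ∣M∣+∣H∣≤3)
    (<⇒≱ (subst (λ hs → 4 ≤ length hs) eq (s≤s (s≤s (s≤s (s≤s z≤n))))))

-- The construction

-- For the lower bound, the singletons of distinct entries are disjoint sets each taking one point.
∣fromList∣≡length : ∀ {v} {xs : List (Fin v)} → Unique xs → ∣ fromList xs ∣ ≡ length xs
∣fromList∣≡length {xs = xs} xs! = ≤-antisym (∣fromList∣≤length xs) (begin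
  length xs                 ≡⟨ length-map ⁅_⁆ xs ⟨
  length (map ⁅_⁆ xs)       ≡⟨ *-identityʳ _ ⟨
  length (map ⁅_⁆ xs) * 1   ≤⟨ disjointIn-count 1 (fromList xs)
                                 (AllPairs.map⁺ (AllPairs.map (λ x≢y z z∈x z∈y _ → x≢y (trans (sym (x∈⁅y⁆⇒x≡y _ z∈x)) (x∈⁅y⁆⇒x≡y _ z∈y))) xs!))
                                 (All.map⁺ (All.tabulate λ {x} x∈xs → nonempty⇒∣p∣>0 (x , x∈p∩q⁺ (x∈⁅x⁆ x , ∈-fromList⁺ x∈xs)))) ⟩
  ∣ fromList xs ∣           ∎)
  where open ≤-Reasoning

to-injective : ∀ {A B : Set} (f : A ↔ B) {x y} → Inverse.to f x ≡ Inverse.to f y → x ≡ y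
to-injective f eq = trans (sym (Inverse.strictlyInverseʳ f _)) (trans (cong (Inverse.from f) eq) (Inverse.strictlyInverseʳ f _))

from-injective : ∀ {A B : Set} (f : A ↔ B) {x y} → Inverse.from f x ≡ Inverse.from f y → x ≡ y
from-injective f eq = trans (sym (Inverse.strictlyInverseˡ f _)) (trans (cong (Inverse.to f) eq) (Inverse.strictlyInverseˡ f _))

+-cong-% : ∀ n .{{_ : NonZero n}} {a b c d} → a % n ≡ b % n → c % n ≡ d % n → (a + c) % n ≡ (b + d) % n
+-cong-% n {a} {b} {c} {d} p q = begin
  (a + c) % n          ≡⟨ %-distribˡ-+ a c n ⟩
  (a % n + c % n) % n  ≡⟨ cong₂ (λ x y → (x + y) % n) p q ⟩
  (b % n + d % n) % n  ≡⟨ %-distribˡ-+ b d n ⟨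
  (b + d) % n          ∎
  where open ≡-Reasoning

-- With `n` equal to `suc m`, adding `k * m` undoes adding `k`, since the two together make a
-- multiple of `n`.
+-cancelˡ-% : ∀ n .{{_ : NonZero n}} k {a b} → (k + a) % n ≡ (k + b) % n → a % n ≡ b % n
+-cancelˡ-% n@(suc m) k {a} {b} eq = begin
  a % n                  ≡⟨ shift a ⟩
  (k * m + (k + a)) % n  ≡⟨ +-cong-% n {k * m} {k * m} {k + a} {k + b} refl eq ⟩
  (k * m + (k + b)) % n  ≡⟨ shift b ⟨
  b % n                  ∎
  where
  open ≡-Reasoning
  open +-*-Solver
  shift : ∀ x → x % n ≡ (k * m + (k + x)) % n
  shift x = trans (sym ([m+kn]%n≡m%n x k n)) (cong (_% n)
    (solve 3 (λ k m x → x :+ k :* (con 1 :+ m) := k :* m :+ (k :+ x)) refl k m x))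

-- The equation says (c - d)(i - j) = 0. The 81 cases are checked by evaluation.
cross-injective : ∀ (c d i j : Fin 3) → c ≢ d →
  toℕ c * toℕ i + toℕ d * toℕ j ≡ toℕ c * toℕ j + toℕ d * toℕ i → i ≡ j
cross-injective = toWitness {a? = Fin.all? λ c → Fin.all? λ d → Fin.all? λ i → Fin.all? λ j →
  ¬? (c Fin.≟ d) →-dec ((toℕ c * toℕ i + toℕ d * toℕ j ≟ toℕ c * toℕ j + toℕ d * toℕ i) →-dec (i Fin.≟ j))} tt

-- For indices up to 2 the sums c i + d j are at most 8, so `9 ≤ n` turns congruences between them
-- into equalities. Points of `Fin v` beyond the first 3 + (3n + s) lie on no block.
module Construction {n s v : ℕ} (n≥9 : 9 ≤ n) (s≤1 : s ≤ 1) (fits : 3 + (3 * n + s) ≤ v) where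

  instance
    n≢0 : NonZero n
    n≢0 = >-nonZero (≤-trans (s≤s z≤n) n≥9)

  -- Besides the points at infinity and the spare points there are three columns
  -- of n cells.  The line (i , a) joins ∞ i to the cells a + c i (mod n) of the
  -- columns c; the line of a spare point joins it to all three points at infinity.
  Line : Set
  Line = (Fin 3 × Fin n) ⊎ Fin s

  -- Cells and spare points are indexed exactly like lines, a column in place of a direction, so
  -- `lineIndex` serves to enumerate both.
  Point : Set
  Point = Fin 3 ⊎ Line

  pattern ∞ i = inj₁ i
  pattern cell c b = inj₂ (inj₁ (c , b))
  pattern spare k = inj₂ (inj₂ k)

  lineIndex : Fin (3 * n + s) ↔ Line
  lineIndex = (Fin.*↔× ⊎-↔ ↔-id (Fin s)) ↔-∘ Fin.+↔⊎

  pointIndex : Fin (3 + (3 * n + s)) ↔ Point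
  pointIndex = (↔-id (Fin 3) ⊎-↔ lineIndex) ↔-∘ Fin.+↔⊎

  encode : Point → Fin v
  encode p = inject≤ (Inverse.from pointIndex p) fits

  encode-injective : ∀ {p q} → encode p ≡ encode q → p ≡ q
  encode-injective eq = from-injective pointIndex (Fin.inject≤-injective fits fits _ _ eq)

  slot : Fin n → Fin 3 → Fin 3 → Fin n
  slot a c i = (toℕ a + toℕ c * toℕ i) mod n

  points : Line → List Point
  points (inj₁ (i , a)) = ∞ i ∷ cell zero (slot a zero i) ∷ cell (suc zero) (slot a (suc zero) i) ∷
                          cell (suc (suc zero)) (slot a (suc (suc zero)) i) ∷ []
  points (inj₂ k) = ∞ zero ∷ ∞ (suc zero) ∷ ∞ (suc (suc zero)) ∷ spare k ∷ []

  points-unique : ∀ l → Unique (points l)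
  points-unique (inj₁ _) = ((λ ()) ∷ (λ ()) ∷ (λ ()) ∷ []) ∷ ((λ ()) ∷ (λ ()) ∷ []) ∷ ((λ ()) ∷ []) ∷ [] ∷ []
  points-unique (inj₂ _) = ((λ ()) ∷ (λ ()) ∷ (λ ()) ∷ []) ∷ ((λ ()) ∷ (λ ()) ∷ []) ∷ ((λ ()) ∷ []) ∷ [] ∷ []

  -- Incidence is given by equations between coordinates, so that matching on points and lines
  -- yields the congruences directly.
  On : Point → Line → Set
  On (∞ j) (inj₁ (i , a)) = j ≡ i
  On (cell c b) (inj₁ (i , a)) = b ≡ slot a c i
  On (spare k) (inj₁ _) = ⊥
  On (∞ j) (inj₂ k) = ⊤
  On (cell c b) (inj₂ k) = ⊥
  On (spare k′) (inj₂ k) = k′ ≡ k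

  ∈-points⇒On : ∀ {p} l → p ∈ₗ points l → On p l
  ∈-points⇒On (inj₁ _) (here refl) = refl
  ∈-points⇒On (inj₁ _) (there (here refl)) = refl
  ∈-points⇒On (inj₁ _) (there (there (here refl))) = refl
  ∈-points⇒On (inj₁ _) (there (there (there (here refl)))) = refl
  ∈-points⇒On (inj₂ _) (here refl) = tt
  ∈-points⇒On (inj₂ _) (there (here refl)) = tt
  ∈-points⇒On (inj₂ _) (there (there (here refl))) = tt
  ∈-points⇒On (inj₂ _) (there (there (there (here refl)))) = refl

  slot≡⇒%≡ : ∀ a b c i j → slot a c i ≡ slot b c j →
    (toℕ a + toℕ c * toℕ i) % n ≡ (toℕ b + toℕ c * toℕ j) % n
  slot≡⇒%≡ a b c i j eq = trans (sym (Fin.toℕ-fromℕ< _)) (trans (cong toℕ eq) (Fin.toℕ-fromℕ< _))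

  toℕ%n : ∀ (a : Fin n) → toℕ a % n ≡ toℕ a
  toℕ%n a = m<n⇒m%n≡m (Fin.toℕ<n a)

  cross<n : ∀ (c d i j : Fin 3) → toℕ c * toℕ i + toℕ d * toℕ j < n
  cross<n c d i j = ≤-trans (s≤s (+-mono-≤ (*-mono-≤ (bound c) (bound i)) (*-mono-≤ (bound d) (bound j)))) n≥9
    where
    bound : ∀ (i : Fin 3) → toℕ i ≤ 2
    bound i = s≤s⁻¹ (Fin.toℕ<n i)

  slot-base-injective : ∀ a b c i → slot a c i ≡ slot b c i → a ≡ b
  slot-base-injective a b c i eq = Fin.toℕ-injective (trans (sym (toℕ%n a)) (trans
    (+-cancelˡ-% n (toℕ c * toℕ i) (subst₂ (λ x y → x % n ≡ y % n) (+-comm (toℕ a) _) (+-comm (toℕ b) _) (slot≡⇒%≡ a b c i i eq)))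
    (toℕ%n b)))

  -- From a + c i ≡ b + c j and b + d j ≡ a + d i, addition and cancelling a + b give c i + d j ≡ c
  -- j + d i, where both sides are below `n`.
  slot-direction : ∀ a b {c d} i j → c ≢ d → slot a c i ≡ slot b c j → slot a d i ≡ slot b d j → i ≡ j
  slot-direction a b {c} {d} i j c≢d eqc eqd = cross-injective c d i j c≢d (begin
    c′ * i′ + d′ * j′        ≡⟨ m<n⇒m%n≡m (cross<n c d i j) ⟨
    (c′ * i′ + d′ * j′) % n  ≡⟨ +-cancelˡ-% n (a′ + b′) (subst₂ (λ x y → x % n ≡ y % n)
                              (rearrange a′ b′ (c′ * i′) (d′ * j′))
                              (trans (rearrange b′ a′ (c′ * j′) (d′ * i′)) (cong (_+ (c′ * j′ + d′ * i′)) (+-comm b′ a′)))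
                              (+-cong-% n (slot≡⇒%≡ a b c i j eqc) (sym (slot≡⇒%≡ a b d i j eqd)))) ⟩
    (c′ * j′ + d′ * i′) % n  ≡⟨ m<n⇒m%n≡m (cross<n c d j i) ⟩
    c′ * j′ + d′ * i′        ∎)
    where
    open ≡-Reasoning
    a′ = toℕ a
    b′ = toℕ b
    c′ = toℕ c
    d′ = toℕ d
    i′ = toℕ i
    j′ = toℕ j
    open +-*-Solver
    rearrange : ∀ a b x y → (a + x) + (b + y) ≡ (a + b) + (x + y)
    rearrange = solve 4 (λ a b x y → (a :+ x) :+ (b :+ y) := (a :+ b) :+ (x :+ y)) refl

  -- Lines of the two kinds can share only points at infinity, and a line of the first kind has just
  -- one of these.
  no-mixed : ∀ {p q l k} → p ≢ q → On p (inj₁ l) → On q (inj₁ l) → On q (inj₂ k) → ¬ On p (inj₂ k)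
  no-mixed {∞ _} {∞ _} p≢q refl refl _ _ = p≢q refl
  no-mixed {∞ _} {cell _ _} _ _ _ ()
  no-mixed {∞ _} {spare _} _ _ ()
  no-mixed {cell _ _} _ _ _ _ ()
  no-mixed {spare _} _ ()

  line-unique : ∀ {p q} → p ≢ q → ∀ l m → On p l → On q l → On p m → On q m → l ≡ m
  -- Two spare lines would share all three points at infinity; `s ≤ 1` leaves at most one such line.
  line-unique p≢q (inj₂ k) (inj₂ k′) _ _ _ _ = cong inj₂ (Fin.toℕ-injective (trans (small k) (sym (small k′))))
    where
    small : ∀ (k : Fin s) → toℕ k ≡ 0
    small k = n<1⇒n≡0 (≤-trans (Fin.toℕ<n k) s≤1)
  line-unique p≢q (inj₁ _) (inj₂ _) pl ql pm qm = contradiction pm (no-mixed p≢q pl ql qm)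
  line-unique p≢q (inj₂ _) (inj₁ _) pl ql pm qm = contradiction pl (no-mixed p≢q pm qm ql)
  line-unique {∞ _} {∞ _} p≢q (inj₁ _) (inj₁ _) refl refl _ _ = contradiction refl p≢q
  line-unique {∞ _} {cell c _} p≢q (inj₁ (i , a)) (inj₁ (_ , b)) refl eq refl eq′ =
    cong (λ a → inj₁ (i , a)) (slot-base-injective a b c i (trans (sym eq) eq′))
  line-unique {cell c _} {∞ _} p≢q (inj₁ (i , a)) (inj₁ (_ , b)) eq refl eq′ refl =
    cong (λ a → inj₁ (i , a)) (slot-base-injective a b c i (trans (sym eq) eq′))
  -- A line has one cell per column, so distinct cells on it lie in different columns and fix its
  -- direction; either cell then fixes its base.
  line-unique {cell c _} {cell d _} p≢q (inj₁ (i , a)) (inj₁ (j , b)) refl refl eqc eqd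
    with refl ← slot-direction a b {c} {d} i j (λ { refl → p≢q (cong (cell c) (trans eqc (sym eqd))) }) eqc eqd =
    cong (λ a → inj₁ (i , a)) (slot-base-injective a b c i eqc)

  block : Line → Subset v
  block l = fromList (map encode (points l))

  ∈-block⁺ : ∀ {p} l → p ∈ₗ points l → encode p ∈ block l
  ∈-block⁺ l p∈l = ∈-fromList⁺ (∈-map⁺ encode p∈l)

  ∈-block⁻ : ∀ {x} l → x ∈ block l → ∃ λ p → x ≡ encode p × On p l
  ∈-block⁻ l x∈ with p , p∈l , x≡ ← ∈-map⁻ encode (∈-fromList⁻ (map encode (points l)) x∈) =
    p , x≡ , ∈-points⇒On l p∈l

  encode∈-block⁻ : ∀ {p} l → encode p ∈ block l → On p l
  encode∈-block⁻ l p∈ with q , eq , on ← ∈-block⁻ l p∈ = subst (λ p → On p l) (sym (encode-injective eq)) on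

  ∣block∣≡4 : ∀ l → ∣ block l ∣ ≡ 4
  ∣block∣≡4 l = trans (∣fromList∣≡length (Unique.map⁺ encode-injective (points-unique l)))
    (trans (length-map encode (points l)) (four l))
    where
    four : ∀ l → length (points l) ≡ 4
    four (inj₁ _) = refl
    four (inj₂ _) = refl

  line-of-pair : ∀ {x y l m} → x ≢ y → x ∈ block l → y ∈ block l → x ∈ block m → y ∈ block m → l ≡ m
  line-of-pair {l = l} {m} x≢y xl yl xm ym
    with p , refl , pl ← ∈-block⁻ l xl | q , refl , ql ← ∈-block⁻ l yl =
    line-unique (λ { refl → x≢y refl }) l m pl ql (encode∈-block⁻ m xm) (encode∈-block⁻ m ym)

  two-points : ∀ l → ∃ λ p → ∃ λ q → p ∈ₗ points l × q ∈ₗ points l × p ≢ q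
  two-points (inj₁ _) = _ , _ , here refl , there (here refl) , λ ()
  two-points (inj₂ _) = _ , _ , here refl , there (here refl) , λ ()

  block-injective : ∀ {l m} → block l ≡ block m → l ≡ m
  block-injective {l} {m} eq with p , q , p∈l , q∈l , p≢q ← two-points l =
    line-of-pair (p≢q ∘ encode-injective) (∈-block⁺ l p∈l) (∈-block⁺ l q∈l)
      (subst (encode p ∈_) eq (∈-block⁺ l p∈l)) (subst (encode q ∈_) eq (∈-block⁺ l q∈l))

  lines : List Line
  lines = tabulate (Inverse.to lineIndex)

  ∈-lines : ∀ l → l ∈ₗ lines
  ∈-lines l = subst (_∈ₗ lines) (Inverse.strictlyInverseˡ lineIndex l) (∈-tabulate⁺ (Inverse.from lineIndex l))

  packing : Packing v 4
  packing = record
    { blocks     = map block lines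
    ; distinct   = Unique.map⁺ block-injective (Unique.tabulate⁺ (to-injective lineIndex))
    ; block-size = All.map⁺ (All.universal ∣block∣≡4 lines)
    ; pair-once  = once
    }
    where
    once : ∀ {x y B C} → x ≢ y → B ∈ₗ map block lines → C ∈ₗ map block lines →
      x ∈ B → y ∈ B → x ∈ C → y ∈ C → B ≡ C
    once x≢y B∈ C∈ with ∈-map⁻ block B∈ | ∈-map⁻ block C∈
    ... | l , _ , refl | m , _ , refl = λ xl yl xm ym → cong block (line-of-pair {l = l} {m} x≢y xl yl xm ym)

  numBlocks-packing : numBlocks packing ≡ 3 * n + s
  numBlocks-packing = trans (length-map block lines) (length-tabulate (Inverse.to lineIndex))

  infinity : Subset v
  infinity = fromList (map (λ i → encode (∞ i)) (allFin 3))

  infinite-point : ∀ l → ∃ λ i → ∞ i ∈ₗ points l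
  infinite-point (inj₁ _) = _ , here refl
  infinite-point (inj₂ _) = _ , here refl

  meets-infinity : ∀ l → 1 ≤ ∣ block l ∩ infinity ∣
  meets-infinity l with i , i∈l ← infinite-point l =
    nonempty⇒∣p∣>0 (encode (∞ i) , x∈p∩q⁺ (∈-block⁺ l i∈l , ∈-fromList⁺ (∈-map⁺ (λ i → encode (∞ i)) (∈-allFin i))))

  -- Every block contains a point at infinity, and four disjoint blocks would need four of them.
  ¬ppc : ¬ PPC packing 4
  ¬ppc ppc = contradiction
    (≤-trans (subst (λ n → n * 1 ≤ ∣ infinity ∣) size
      (disjointIn-count 1 infinity
        (AllPairs.map (λ B#C y y∈B y∈C _ → B#C (y , x∈p∩q⁺ (y∈B , y∈C))) disjoint)
        (All.tabulate λ B∈ → meets (⊆-blocks B∈))))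
      (∣fromList∣≤length (map (λ i → encode (∞ i)) (allFin 3))))
    (<⇒≱ ≤-refl)
    where
    open PPC ppc
    meets : ∀ {B} → B ∈ₗ map block lines → 1 ≤ ∣ B ∩ infinity ∣
    meets B∈ with l , _ , refl ← ∈-map⁻ block B∈ = meets-infinity l

  -- Taking base `i` in direction `i` puts the cell of column c at (c + 1) i. These values are at
  -- most 6, hence below `n`, and differ for different `i`.
  diagonal : Fin 3 → Line
  diagonal i = inj₁ (i , inject≤ i (≤-trans (s≤s (s≤s (s≤s z≤n))) n≥9))

  diagonal-disjoint : ∀ {p} i j → On p (diagonal i) → On p (diagonal j) → i ≡ j
  diagonal-disjoint {∞ _} i j refl refl = refl
  diagonal-disjoint {cell c _} i j refl eq = Fin.toℕ-injective (*-cancelˡ-≡ (toℕ i) (toℕ j) (suc (toℕ c)) (begin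
    suc (toℕ c) * toℕ i          ≡⟨ m<n⇒m%n≡m (small i) ⟨
    (suc (toℕ c) * toℕ i) % n    ≡⟨ subst₂ (λ x y → (x + toℕ c * toℕ i) % n ≡ (y + toℕ c * toℕ j) % n)
                                      (Fin.toℕ-inject≤ i _) (Fin.toℕ-inject≤ j _) (slot≡⇒%≡ (inject≤ i _) (inject≤ j _) c i j eq) ⟩
    (suc (toℕ c) * toℕ j) % n    ≡⟨ m<n⇒m%n≡m (small j) ⟩
    suc (toℕ c) * toℕ j          ∎))
    where
    open ≡-Reasoning
    small : ∀ i → suc (toℕ c) * toℕ i < n
    small i = ≤-trans (s≤s (*-mono-≤ (Fin.toℕ<n c) (s≤s⁻¹ (Fin.toℕ<n i)))) (≤-trans (m≤n+m 7 2) n≥9)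

  ppc : PPC packing 3
  ppc = record
    { members  = tabulate (block ∘ diagonal)
    ; distinct = Unique.tabulate⁺ (λ eq → diagonal-injective (block-injective eq))
    ; ⊆-blocks = λ B∈ → member (∈-tabulate⁻ B∈)
    ; disjoint = AllPairs.tabulate⁺ disj
    ; size     = refl
    }
    where
    diagonal-injective : ∀ {i j} → diagonal i ≡ diagonal j → i ≡ j
    diagonal-injective refl = refl
    member : ∀ {B} → (∃ λ i → B ≡ block (diagonal i)) → B ∈ₗ map block lines
    member (i , refl) = ∈-map⁺ block (∈-lines (diagonal i))
    disj : ∀ {i j} → i ≢ j → Disjoint (block (diagonal i)) (block (diagonal j))
    disj {i} {j} i≢j (x , x∈) with x∈i , x∈j ← x∈p∩q⁻ (block (diagonal i)) (block (diagonal j)) x∈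
      with p , refl , on ← ∈-block⁻ (diagonal i) x∈i =
      i≢j (diagonal-disjoint {p} i j on (encode∈-block⁻ (diagonal j) x∈j))

-- The argument is v mod 3. For remainder 2 both leftover points stay off all blocks, which accounts
-- for the bound `v ∸ 5`.
spares : ℕ → ℕ
spares 1 = 1
spares _ = 0

spares≤1 : ∀ r → spares r ≤ 1
spares≤1 0 = z≤n
spares≤1 1 = ≤-refl
spares≤1 (suc (suc _)) = z≤n

spares≤ : ∀ r → spares r ≤ r
spares≤ 0 = z≤n
spares≤ 1 = ≤-refl
spares≤ (suc (suc _)) = z≤n

large-packing : ∀ {v} → v ≥ 147 → ∃ λ (P : Packing v 4) → MaxPPCSize P 3
  × ((v % 3 ≡ 0) ⊎ (v % 3 ≡ 1) → v ∸ 3 ≤ numBlocks P)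
  × (v % 3 ≡ 2 → v ∸ 5 ≤ numBlocks P)
large-packing {v} v≥147 = packing , (ppc , ¬ppc) ,
  (λ r≡ → numBlocks-≥ 3 (+-monoʳ-≤ 3 (r≤s r≡))) ,
  (λ r≡ → numBlocks-≥ 5 (subst (λ r → 3 + r ≤ 5 + spares r) (sym r≡) ≤-refl))
  where
  r = v % 3
  -- One of the v / 3 triples of points is set aside as the points at infinity.
  n = v / 3 ∸ 1
  s = spares r
  q≥49 : 49 ≤ v / 3
  q≥49 = /-mono-≤ v≥147 ≤-refl
  v≡ : v ≡ 3 + (3 * n + r)
  v≡ = begin
    v                ≡⟨ m≡m%n+[m/n]*n v 3 ⟩
    r + v / 3 * 3    ≡⟨ cong (λ q → r + q * 3) (m+[n∸m]≡n (≤-trans (s≤s z≤n) q≥49)) ⟨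
    r + suc n * 3    ≡⟨ solve 2 (λ r n → r :+ (con 1 :+ n) :* con 3 := con 3 :+ (con 3 :* n :+ r)) refl r n ⟩
    3 + (3 * n + r)  ∎
    where
    open ≡-Reasoning
    open +-*-Solver
  open Construction {n} {s} {v} (≤-trans (m≤n+m 9 39) (∸-monoˡ-≤ 1 q≥49)) (spares≤1 r)
    (subst (3 + (3 * n + s) ≤_) (sym v≡) (+-monoʳ-≤ 3 (+-monoʳ-≤ (3 * n) (spares≤ r))))
  r≤s : (r ≡ 0) ⊎ (r ≡ 1) → r ≤ s
  r≤s (inj₁ r≡0) = subst (λ r → r ≤ spares r) (sym r≡0) z≤n
  r≤s (inj₂ r≡1) = subst (λ r → r ≤ spares r) (sym r≡1) ≤-refl
  numBlocks-≥ : ∀ k → 3 + r ≤ k + s → v ∸ k ≤ numBlocks packing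
  numBlocks-≥ k r≤ = m≤n+o⇒m∸n≤o v k (begin
    v                         ≡⟨ v≡ ⟩
    3 + (3 * n + r)           ≡⟨ solve 2 (λ m r → con 3 :+ (m :+ r) := con 3 :+ r :+ m) refl (3 * n) r ⟩
    3 + r + 3 * n             ≤⟨ +-monoˡ-≤ (3 * n) r≤ ⟩
    k + s + 3 * n             ≡⟨ solve 3 (λ k s m → k :+ s :+ m := k :+ (m :+ s)) refl k s (3 * n) ⟩
    k + (3 * n + s)           ≡⟨ cong (k +_) numBlocks-packing ⟨
    k + numBlocks packing     ∎)
    where
    open ≤-Reasoning
    open +-*-Solver

-- Existence of the maximum

-- The search descends from the bound `N`, each failure lowering it by one; the given witness stops
-- the descent at zero at the latest.
maximum-exists : ∀ {Q : ℕ → Set} → Decidable Q → ∀ N → ∃ Q → (∀ b → Q b → b ≤ N) →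
  ∃ λ m → Q m × (∀ b → Q b → b ≤ m)
maximum-exists Q? N (a , qa) bound with Q? N
... | yes q = N , q , bound
maximum-exists {Q} Q? zero (a , qa) bound | no ¬q =
  contradiction (subst Q (n≤0⇒n≡0 (bound a qa)) qa) ¬q
maximum-exists Q? (suc N) (a , qa) bound | no ¬q = maximum-exists Q? N (a , qa)
  λ b qb → s≤s⁻¹ (≤∧≢⇒< (bound b qb) λ { refl → ¬q qb })

-- Fixing the length makes the search finite; both packings with a given number of blocks and PPCs
-- of a given size are found this way.
subsetList? : ∀ {v} n {Q : List (Subset v) → Set} → Decidable Q → Dec (∃ λ L → length L ≡ n × Q L)
subsetList? zero Q? = map′ (λ q → [] , refl , q) (λ { ([] , _ , q) → q }) (Q? [])
subsetList? (suc n) Q? = map′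
  (λ { (B , L , eq , q) → B ∷ L , cong suc eq , q })
  (λ { (B ∷ L , eq , q) → B , L , suc-injective eq , q })
  (anySubset? λ B → subsetList? n λ L → Q? (B ∷ L))

_≟ₛ_ : ∀ {v} → DecidableEquality (Subset v)
_≟ₛ_ = Vec.≡-dec Bool._≟_

unique? : ∀ {v} → Decidable (Unique {A = Subset v})
unique? = allPairs? λ B C → ¬? (B ≟ₛ C)

-- This is `pair-once` with all quantifiers over the given list or over `Fin v`, hence decidable.
PairOnce : ∀ {v} → List (Subset v) → Set
PairOnce {v} L = All (λ B → All (λ C → ∀ (x y : Fin v) → x ≢ y → x ∈ B → y ∈ B → x ∈ C → y ∈ C → B ≡ C) L) L

pairOnce? : ∀ {v} → Decidable (PairOnce {v})
pairOnce? L = all? (λ B → all? (λ C → Fin.all? λ x → Fin.all? λ y →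
  ¬? (x Fin.≟ y) →-dec (x ∈? B →-dec (y ∈? B →-dec (x ∈? C →-dec (y ∈? C →-dec (B ≟ₛ C)))))) L) L

HasPPC : ∀ {v} → ℕ → List (Subset v) → Set
HasPPC ρ L = ∃ λ M → length M ≡ ρ × Unique M × All (_∈ₗ L) M × AllPairs Disjoint M

hasPPC? : ∀ {v} ρ → Decidable (HasPPC {v} ρ)
hasPPC? ρ L = subsetList? ρ λ M →
  unique? M ×-dec (all? (λ B → member? _≟ₛ_ B L) M ×-dec allPairs? (λ B C → ¬? (nonempty? (B ∩ C))) M)

hasPPC⇒PPC : ∀ {v k ρ} {P : Packing v k} → HasPPC ρ (blocks P) → PPC P ρ
hasPPC⇒PPC (M , size , M! , M⊆P , disj) = record
  { members = M ; distinct = M! ; ⊆-blocks = All.lookup M⊆P ; disjoint = disj ; size = size }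

PPC⇒hasPPC : ∀ {v k ρ} {P : Packing v k} → PPC P ρ → HasPPC ρ (blocks P)
PPC⇒hasPPC ppc = members , size , PPC.distinct ppc , All.tabulate ⊆-blocks , disjoint
  where open PPC ppc

attained? : ∀ v k ρ → Decidable λ b → ∃ λ (P : Packing v k) → MaxPPCSize P ρ × numBlocks P ≡ b
attained? v k ρ b = map′
  (λ (L , size , (L! , sizes , once) , has , hasn't) →
    record { blocks = L ; distinct = L! ; block-size = sizes
           ; pair-once = λ x≢y B∈ C∈ → All.lookup (All.lookup once B∈) C∈ _ _ x≢y } ,
    (hasPPC⇒PPC has , λ ppc → hasn't (PPC⇒hasPPC ppc)) , size)
  (λ (P , (ppc , ¬ppc) , size) →
    blocks P , size ,
    (Packing.distinct P , block-size P , All.tabulate λ B∈ → All.tabulate λ C∈ _ _ x≢y → pair-once P x≢y B∈ C∈) ,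
    PPC⇒hasPPC ppc , λ has → ¬ppc (hasPPC⇒PPC has))
  (subsetList? b λ L → (unique? L ×-dec (all? (λ B → ∣ B ∣ ≟ k) L ×-dec pairOnce? L))
                       ×-dec (hasPPC? ρ L ×-dec ¬? (hasPPC? (suc ρ) L)))

theorem4p3 : ∀ (v : ℕ) → v ≥ 147 →
    ∃ λ (b : ℕ) → (β[ 3 , v , 4 ]≡ b)
    × (b ≤ v ∸ 2)
    × ((v % 3 ≡ 0) ⊎ (v % 3 ≡ 1) → v ∸ 3 ≤ b)
    × (v % 3 ≡ 2 → v ∸ 5 ≤ b)
theorem4p3 v v≥147 = assemble
  -- The upper bound starts the search and the constructed packing shows that it succeeds; comparing
  -- that packing with the maximum gives the lower bounds.
  (maximum-exists (attained? v 4 3) (v ∸ 2) (_ , P , maxP , refl) upper)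
  where
  P = proj₁ (large-packing v≥147)
  maxP = proj₁ (proj₂ (large-packing v≥147))
  lower = proj₂ (proj₂ (large-packing v≥147))
  upper : ∀ b → (∃ λ (P : Packing v 4) → MaxPPCSize P 3 × numBlocks P ≡ b) → b ≤ v ∸ 2
  upper _ (P′ , (_ , ¬ppc) , refl) = numBlocks-≤ v≥147 P′ ¬ppc
  assemble : (∃ λ b → (∃ λ (P : Packing v 4) → MaxPPCSize P 3 × numBlocks P ≡ b)
                      × (∀ b′ → (∃ λ (P : Packing v 4) → MaxPPCSize P 3 × numBlocks P ≡ b′) → b′ ≤ b)) → _
  assemble (b , att , top) = b ,
    record { attained = att ; maximal = λ P′ max′ → top _ (P′ , max′ , refl) } ,
    upper b att ,
    (λ r≡ → ≤-trans (proj₁ lower r≡) (top _ (P , maxP , refl))) ,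
    (λ r≡ → ≤-trans (proj₂ lower r≡) (top _ (P , maxP , refl)))
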